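{- For all $n\ge 1$ and $k\in[n]$, the mapping $\varphi:\mathcal{A}_{n,k}\to\mathcal{T}_{n,k}$ (defined recursively in the context) is a bijection between $\mathcal{A}_{n,k}$, the set of alternating permutations $\pi$ of $[n]$ with $\pi_1=k$, and $\mathcal{T}_{n,k}$, the set of 0-1-2 increasing trees $T$ on $[n]$ with $p(T)=k$. It satisfies $$\pi_1=p(\varphi(\pi))\qquad\text{for every }\pi\in\mathcal{A}_{n,k}.$$
   Context: **Permutations.** $[n]:=\{1,2,\dots,n\}$. $\mathcal{A}_n$ is the set of alternating permutations of $[n]$, i.e. permutations $\pi=\pi_1\pi_2\cdots\pi_n$ of $[n]$ with $\pi_1>\pi_2<\pi_3>\pi_4<\cdots$. Put $\mathcal{A}_{n,k}=\{\pi\in\mathcal{A}_n:\pi_1=k\}$. **Trees.** A 0-1-2 increasing tree on a finite nonempty set $S$ of integers is a rooted tree with vertex set $S$ in which every vertex has at most two children, the children of a vertex are not ordered, and every non-root vertex is larger than its parent (so the root is $\min S$). $\mathcal{T}_n$ is the set of 0-1-2 increasing trees on $[n]$. The main chain of such a tree $T$ is the path that starts at the root and moves, at each vertex, to its smallest child, until a leaf is reached. That leaf is denoted $p(T)$. Put $\mathcal{T}_{n,k}=\{T\in\mathcal{T}_n:p(T)=k\}$. Two distinct vertices are siblings if they have the same parent. "Relabeling" a permutation or tree by a set means applying the order-preserving bijection between the label sets. **The mapping $\varphi:\mathcal{A}_{n,k}\to\mathcal{T}_{n,k}$.** For $n=1$ and $n=2$, $|\mathcal{A}_n|=|\mathcal{T}_n|=1$,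 and $\varphi$ sends the unique element of $\mathcal{A}_n$ to the unique element of $\mathcal{T}_n$. For $n\ge 3$ and $\pi\in\mathcal{A}_{n,k}$ (so $k=\pi_1$), $\varphi(\pi)$ is defined recursively as follows. (a) Suppose $\pi_2=k-1$. Let $i=\pi_3$, so that $i>k$. Let $\pi'\in\mathcal{A}_{n-2,i-2}$ be obtained by deleting $k$ and $k-1$ from $\pi$ and relabeling by $[n-2]$. Let $T'=\varphi(\pi')\in\mathcal{T}_{n-2,i-2}$, and let $T''$ be $T'$ relabeled by $\{1,\dots,k-2,k+1,\dots,n\}$. Let $m$ be the smallest vertex greater than $k$ on the main chain of $T''$, and let $j$ be the parent of $m$ in $T''$. Replace the edge $(j,m)$ by the two edges $(j,k-1)$ and $(k-1,m)$, so that $k-1$ is a child of $j$ and $m$ is a child of $k-1$, and add $k$ as a new leaf child of $k-1$. If $m$ is the root of $T''$ (this happens exactly when $k=2$), there is no $j$, and $k-1=1$ becomes the new root, with children $k=2$ and $m$. The resulting tree is $\varphi(\pi)$. (b) Suppose $\pi_2<k-1$. Let $\pi'\in\mathcal{A}_{n,k-1}$ be obtained from $\pi$ by exchanging the values $k-1$ and $k$, and let $T'=\varphi(\pi')\in\mathcal{T}_{n,k-1}$, so that $k-1=p(T')$ is a leaf of $T'$. (b1) If $k$ is a sibling of $k-1$ in $T'$, let $j$ be their common parent. Let $A$ be the subtree of $T'$ rooted at the smallest child of $k$ (empty if $k$ has no child), and let $B$ be the subtree rooted at the other child of $k$ (empty if $k$ has at most one child). Then $\varphi(\pi)$ is obtained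 from $T'$ by rearranging the part above $j$ as follows: the children of $j$ are $k-1$ and the root of $A$ (if $A$ is nonempty), and the children of $k-1$ are $k$, which is a leaf, and the root of $B$ (if $B$ is nonempty). The subtrees $A$ and $B$ and the rest of the tree are unchanged. (b2) If $k$ is not a sibling of $k-1$ in $T'$, then $\varphi(\pi)$ is obtained from $T'$ by exchanging the labels $k-1$ and $k$. -}

module Defs where

open import Data.List.Base using (List; []; _∷_; _++_; map; head; applyUpTo)
open import Data.List.Relation.Binary.Permutation.Propositional using (_↭_)
open import Data.Maybe.Base as Maybe using (Maybe; just; nothing; _>>=_)
open import Data.Nat.Base using (ℕ; zero; suc; _+_; _∸_; _<_; _>_)
open import Data.Nat.Properties using (_≟_; _<?_; <-cmp)
open import Data.Empty using (⊥)
open import Data.Product.Base using (_×_)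
open import Data.Sum.Base using (_⊎_)
open import Relation.Binary.Definitions using (Tri; tri<; tri≈; tri>)
open import Relation.Binary.PropositionalEquality using (_≡_)
open import Relation.Nullary using (Dec; yes; no; _×-dec_; _⊎-dec_)

[1⋯_] : ℕ → List ℕ
[1⋯ n ] = applyUpTo suc n

-- Permutations of [n] are words in one-line notation.  `Alternating↓` is
-- π₁ > π₂ < π₃ > ⋯ and `Alternating↑` is π₁ < π₂ > π₃ < ⋯.

data Alternating↓ : List ℕ → Set
data Alternating↑ : List ℕ → Set

data Alternating↓ where
  []   : Alternating↓ []
  [-]  : ∀ {x} → Alternating↓ (x ∷ [])
  _∷_  : ∀ {x y π} → x > y → Alternating↑ (y ∷ π) → Alternating↓ (x ∷ y ∷ π)

data Alternating↑ where
  [-]  : ∀ {x} → Alternating↑ (x ∷ [])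
  _∷_  : ∀ {x y π} → x < y → Alternating↓ (y ∷ π) → Alternating↑ (x ∷ y ∷ π)

record 𝒜 (n k : ℕ) : Set where
  field
    word        : List ℕ
    permutation : word ↭ [1⋯ n ]
    alternating : Alternating↓ word
    first       : head word ≡ just k

-- Vertices of a tree carry distinct labels, so an unordered pair of siblings
-- has exactly one listing with the smaller root first.  `Increasing` requires
-- that listing; on increasing trees `_≡_` is therefore equality of trees with
-- unordered children, and the first child is the smallest child.

data Tree : Set where
  leaf  : ℕ → Tree
  node₁ : ℕ → Tree → Tree
  node₂ : ℕ → Tree → Tree → Tree

root : Tree → ℕ
root (leaf x)      = x
root (node₁ x _)   = x
root (node₂ x _ _) = x

vertices : Tree → List ℕ
vertices (leaf x)      = x ∷ []
vertices (node₁ x s)   = x ∷ vertices s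
vertices (node₂ x s t) = x ∷ vertices s ++ vertices t

data Increasing : Tree → Set where
  leaf  : ∀ {x} → Increasing (leaf x)
  node₁ : ∀ {x s} → x < root s → Increasing s → Increasing (node₁ x s)
  node₂ : ∀ {x s t} → x < root s → x < root t → root s < root t →
          Increasing s → Increasing t → Increasing (node₂ x s t)

-- The leaf at the end of the main chain.
p : Tree → ℕ
p (leaf x)      = x
p (node₁ _ s)   = p s
p (node₂ _ s _) = p s

record 𝒯 (n k : ℕ) : Set where
  field
    tree       : Tree
    vertexSet  : vertices tree ↭ [1⋯ n ]
    increasing : Increasing tree
    chainEnd   : p tree ≡ k

mapTree : (ℕ → ℕ) → Tree → Tree
mapTree f (leaf x)      = leaf (f x)
mapTree f (node₁ x s)   = node₁ (f x) (mapTree f s)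
mapTree f (node₂ x s t) = node₂ (f x) (mapTree f s) (mapTree f t)

Siblings : ℕ → ℕ → Tree → Set
Siblings u v (leaf _)      = ⊥
Siblings u v (node₁ _ s)   = Siblings u v s
Siblings u v (node₂ _ s t) =
  (root s ≡ u × root t ≡ v) ⊎ (root s ≡ v × root t ≡ u) ⊎
  Siblings u v s ⊎ Siblings u v t

siblings? : ∀ u v T → Dec (Siblings u v T)
siblings? u v (leaf _)      = no λ ()
siblings? u v (node₁ _ s)   = siblings? u v s
siblings? u v (node₂ _ s t) =
  (root s ≟ u ×-dec root t ≟ v) ⊎-dec (root s ≟ v ×-dec root t ≟ u) ⊎-dec
  siblings? u v s ⊎-dec siblings? u v t

-- From here on u = k − 1 and v = k.

-- The order-preserving bijections between {1,…,n} ∖ {u, u+1} and {1,…,n−2}.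

squeeze : ℕ → ℕ → ℕ
squeeze u x with x <? u
... | yes _ = x
... | no  _ = x ∸ 2

spread : ℕ → ℕ → ℕ
spread u x with x <? u
... | yes _ = x
... | no  _ = x + 2

exchange : ℕ → ℕ → ℕ → ℕ
exchange u v x with x ≟ u | x ≟ v
... | yes _ | _     = v
... | no _  | yes _ = u
... | no _  | no _  = x

-- Labels increase along the main chain, so the smallest vertex m > v on it is
-- the first one met from the root.  The subtree at m becomes the second child
-- of u.  The result is `nothing` if there is no such m.
insert : ℕ → ℕ → Tree → Maybe Tree
insert u v T with v <? root T
insert u v T             | yes _ = just (node₂ u (leaf v) T)
insert u v (leaf _)      | no _  = nothing
insert u v (node₁ x s)   | no _  = Maybe.map (node₁ x) (insert u v s)
insert u v (node₂ x s t) | no _  = Maybe.map (λ s′ → node₂ x s′ t) (insert u v s)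

-- `regroup j U V` is the new subtree at j when its children were U, the leaf u,
-- and V, the subtree at v, whose children are the roots of A and B.
regroup : ℕ → Tree → Tree → Maybe Tree
regroup j (leaf u) (leaf v)      = just (node₁ j (node₁ u (leaf v)))
regroup j (leaf u) (node₁ v A)   = just (node₂ j (node₁ u (leaf v)) A)
regroup j (leaf u) (node₂ v A B) = just (node₂ j (node₂ u (leaf v) B) A)
regroup j _        _             = nothing

-- The common parent j of u = p T and v lies on the main chain, so only that
-- chain is searched for it.
rearrange : ℕ → ℕ → Tree → Maybe Tree
rearrange u v (leaf _)      = nothing
rearrange u v (node₁ x s)   = Maybe.map (node₁ x) (rearrange u v s)
rearrange u v (node₂ x s t) with root s ≟ u ×-dec root t ≟ v
... | yes _ = regroup x s t
... | no  _ = Maybe.map (λ s′ → node₂ x s′ t) (rearrange u v s)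

unexchange : ℕ → ℕ → Tree → Maybe Tree
unexchange u v T with siblings? u v T
... | yes _ = rearrange u v T
... | no  _ = just (mapTree (exchange u v) T)

-- Not a `with` inside φ, which would hide the lexicographic descent in (n , k)
-- from the termination checker.
select : ∀ {x y} → Tri (x < y) (x ≡ y) (x > y) →
         (lt eq gt : Maybe Tree) → Maybe Tree
select (tri< _ _ _) lt eq gt = lt
select (tri≈ _ _ _) lt eq gt = eq
select (tri> _ _ _) lt eq gt = gt

-- `φ n k π` is meant for π ∈ 𝒜 n k, and is `nothing` when some step of the
-- recursion cannot be carried out.
φ : ℕ → ℕ → List ℕ → Maybe Tree
φ 1 _ _ = just (leaf 1)
φ 2 _ _ = just (node₁ 1 (leaf 2))
φ (suc (suc (suc n))) (suc u) (π₁ ∷ π₂ ∷ π₃ ∷ π) = select (<-cmp π₂ u)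
  (φ (suc (suc (suc n))) u (map (exchange u (suc u)) (π₁ ∷ π₂ ∷ π₃ ∷ π)) >>= λ T′ →
   unexchange u (suc u) T′)
  (φ (suc n) (π₃ ∸ 2) (map (squeeze u) (π₃ ∷ π)) >>= λ T′ →
   insert u (suc u) (mapTree (spread u) T′))
  nothing
φ _ _ _ = nothing

{-# OPTIONS --safe #-}

-- Besides the two base cases, T = φ π arises from a smaller (n , k) in one of
-- three ways: a pair u, u + 1 is inserted into the main chain, the subtree at
-- the parent of the siblings u, u + 1 is rearranged, or the labels u, u + 1 are
-- exchanged.  Each way is injective, and T tells which one occurred: u is the
-- parent of u + 1 = p T in the first two cases but not in the third.  When it
-- is, the first two are separated by whether u has a second child B and, if the
-- parent of u has a second child A, by the order of the roots of A and B.
-- Conversely every tree with p T = u + 1 falls under one of the cases, so the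
-- graph Φ of φ is a bijection by induction on (n , k).

module Submission where

open import Defs
open import Data.Empty using (⊥; ⊥-elim)
open import Data.List.Base using (List; []; _∷_; _++_; _∷ʳ_; map; head; length)
open import Data.List.Membership.Propositional using (_∈_)
open import Data.List.Membership.Propositional.Properties using (∈-++⁺ˡ; ∈-++⁺ʳ)
open import Data.List.Properties using (map-++; map-∘; map-id-local; applyUpTo-∷ʳ; length-++; length-applyUpTo)
open import Data.List.Relation.Binary.Disjoint.Propositional using (Disjoint)
open import Data.List.Relation.Binary.Permutation.Propositional
  using (_↭_; prep; swap; ↭-refl; ↭-sym; ↭-trans; ↭-reflexive; ↭⇒↭ₛ; module PermutationReasoning)
open import Data.List.Relation.Binary.Permutation.Propositional.Properties
  using (All-resp-↭; ∈-resp-↭; ↭-length; ↭-singleton-inv; ++⁺ʳ; ++-comm; ∷↭∷ʳ; shifts; drop-∷)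
  renaming (map⁺ to ↭-map⁺)
open import Data.List.Relation.Binary.Permutation.Setoid.Properties using (Unique-resp-↭)
open import Data.List.Relation.Unary.All as All using (All; []; _∷_)
open import Data.List.Relation.Unary.All.Properties using (++⁻ˡ; ++⁻ʳ)
  renaming (map⁺ to All-map⁺; applyUpTo⁺₁ to All-applyUpTo⁺)
open import Data.List.Relation.Unary.AllPairs using ([]; _∷_)
open import Data.List.Relation.Unary.Any using (here; there)
open import Data.List.Relation.Unary.Unique.Propositional using (Unique)
open import Data.List.Relation.Unary.Unique.Propositional.Properties using ()
  renaming (applyUpTo⁺₁ to Unique-applyUpTo⁺)
open import Data.Maybe.Base as Maybe using (just; _>>=_)
open import Data.Maybe.Properties using (just-injective)
open import Data.Nat.Base using (ℕ; zero; suc; _+_; _∸_; _≤_; _<_; z≤n; s≤s; s≤s⁻¹)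
open import Data.Nat.Properties
open import Data.Product.Base using (Σ-syntax; ∃; ∃₂; _×_; _,_; proj₁; proj₂)
open import Data.Sum.Base as Sum using (_⊎_; inj₁; inj₂)
open import Data.Unit.Base using (⊤; tt)
open import Function.Base using (_on_; _∘_)
open import Function.Definitions using (Bijective)
open import Relation.Binary.Definitions using (tri<; tri≈; tri>)
open import Relation.Binary.PropositionalEquality
  using (_≡_; _≢_; refl; sym; trans; cong; cong₂; subst; subst₂; setoid; ≢-sym)
open import Relation.Nullary using (¬_; Dec; yes; no; contradiction; _×-dec_; _⊎-dec_)

private
  variable
    i k n u v x y : ℕ
    w w′ : List ℕ
    S S′ T : Tree

-- Relabellings

<⇒suc< : u < x → x ≢ suc u → suc u < x
<⇒suc< u<x x≢v = ≤∧≢⇒< u<x (≢-sym x≢v)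

exchange-left : ∀ u v → exchange u v u ≡ v
exchange-left u v with u ≟ u
... | yes _   = refl
... | no  u≢u = contradiction refl u≢u

exchange-right : ∀ u v → exchange u v v ≡ u
exchange-right u v with v ≟ u | v ≟ v
... | yes v≡u | _       = v≡u
... | no _    | yes _   = refl
... | no _    | no  v≢v = contradiction refl v≢v

exchange-other : x ≢ u → x ≢ v → exchange u v x ≡ x
exchange-other {x} {u} {v} x≢u x≢v with x ≟ u | x ≟ v
... | yes x≡u | _       = contradiction x≡u x≢u
... | no _    | yes x≡v = contradiction x≡v x≢v
... | no _    | no _    = refl

exchange-involutive : ∀ u v x → exchange u v (exchange u v x) ≡ x
exchange-involutive u v x with x ≟ u | x ≟ v
... | yes refl | _        = exchange-right u v
... | no _     | yes refl = exchange-left u v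
... | no x≢u   | no x≢v   = exchange-other x≢u x≢v

exchange≡left : ∀ u v → exchange u v x ≡ u → x ≡ v
exchange≡left {x} u v eq =
  trans (sym (exchange-involutive u v x)) (trans (cong (exchange u v) eq) (exchange-left u v))

exchange≡right : ∀ u v → exchange u v x ≡ v → x ≡ u
exchange≡right {x} u v eq =
  trans (sym (exchange-involutive u v x)) (trans (cong (exchange u v) eq) (exchange-right u v))

-- No label lies strictly between u and u + 1, so swapping these two can reverse only the comparison
-- of the one with the other.
exchange-mono : x < y → ¬ (x ≡ u × y ≡ suc u) → exchange u (suc u) x < exchange u (suc u) y
exchange-mono {x} {y} {u} x<y ¬uv with x ≟ u | x ≟ suc u | y ≟ u | y ≟ suc u
... | yes refl | _        | yes refl | _        = contradiction x<y (<-irrefl refl)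
... | yes refl | _        | no _     | yes refl = contradiction (refl , refl) ¬uv
... | yes refl | _        | no _     | no y≢v   = <⇒suc< x<y y≢v
... | no _     | yes refl | yes refl | _        = contradiction x<y (<-asym (n<1+n _))
... | no _     | yes refl | no _     | yes refl = contradiction x<y (<-irrefl refl)
... | no _     | yes refl | no _     | no _     = <-trans (n<1+n _) x<y
... | no _     | no _     | yes refl | _        = <-trans x<y (n<1+n _)
... | no x≢u   | no _     | no _     | yes refl = ≤∧≢⇒< (s≤s⁻¹ x<y) x≢u
... | no _     | no _     | no _     | no _     = x<y

map-exchange-involutive : ∀ u v w → map (exchange u v) (map (exchange u v) w) ≡ w
map-exchange-involutive u v w =
  trans (sym (map-∘ w)) (map-id-local (All.universal (exchange-involutive u v) w))

-- The image of `spread u`, and the set on which `squeeze u` inverts it and keeps the order.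
Outside : ℕ → ℕ → Set
Outside u x = x < u ⊎ suc u < x

spread-< : x < u → spread u x ≡ x
spread-< {x} {u} x<u with x <? u
... | yes _   = refl
... | no  x≮u = contradiction x<u x≮u

spread-≥ : u ≤ x → spread u x ≡ suc (suc x)
spread-≥ {u} {x} u≤x with x <? u
... | yes x<u = contradiction u≤x (<⇒≱ x<u)
... | no  _   = +-comm x 2

squeeze-< : x < u → squeeze u x ≡ x
squeeze-< {x} {u} x<u with x <? u
... | yes _   = refl
... | no  x≮u = contradiction x<u x≮u

squeeze-> : suc u < x → squeeze u x ≡ x ∸ 2
squeeze-> {u} {x} v<x with x <? u
... | yes x<u = contradiction x<u (<-asym (<-trans (n<1+n _) v<x))
... | no  _   = refl

spread-outside : ∀ u x → Outside u (spread u x)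
spread-outside u x with x <? u
... | yes x<u = inj₁ x<u
... | no  x≮u rewrite +-comm x 2 = inj₂ (s≤s (s≤s (≮⇒≥ x≮u)))

squeeze-spread : ∀ u x → squeeze u (spread u x) ≡ x
squeeze-spread u x with x <? u
... | yes x<u = squeeze-< x<u
... | no  x≮u rewrite +-comm x 2 = squeeze-> (s≤s (s≤s (≮⇒≥ x≮u)))

spread-squeeze : Outside u x → spread u (squeeze u x) ≡ x
spread-squeeze (inj₁ x<u) rewrite squeeze-< x<u = spread-< x<u
spread-squeeze (inj₂ v<x@(s≤s (s≤s u≤x))) rewrite squeeze-> v<x = spread-≥ u≤x

spread-mono : ∀ u → x < y → spread u x < spread u y
spread-mono {x} {y} u x<y with x <? u | y <? u
... | yes _   | yes _   = x<y
... | yes _   | no _    = m≤n⇒m≤n+o 2 x<y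
... | no x≮u  | yes y<u = contradiction (<-trans x<y y<u) x≮u
... | no _    | no _    = +-monoˡ-< 2 x<y

squeeze-mono : Outside u x → Outside u y → x < y → squeeze u x < squeeze u y
squeeze-mono (inj₁ x<u) (inj₁ y<u) x<y rewrite squeeze-< x<u | squeeze-< y<u = x<y
squeeze-mono (inj₁ x<u) (inj₂ v<y@(s≤s (s≤s u≤y))) x<y
  rewrite squeeze-< x<u | squeeze-> v<y = <-≤-trans x<u u≤y
squeeze-mono (inj₂ v<x) (inj₁ y<u) x<y =
  contradiction (<-trans x<y y<u) (<-asym (<-trans (n<1+n _) v<x))
squeeze-mono (inj₂ v<x@(s≤s (s≤s _))) (inj₂ v<y@(s≤s (s≤s _))) x<y
  rewrite squeeze-> v<x | squeeze-> v<y = s≤s⁻¹ (s≤s⁻¹ x<y)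

map-squeeze-spread : ∀ u w → map (squeeze u) (map (spread u) w) ≡ w
map-squeeze-spread u w =
  trans (sym (map-∘ w)) (map-id-local (All.universal (squeeze-spread u) w))

map-spread-squeeze : All (Outside u) w → map (spread u) (map (squeeze u) w) ≡ w
map-spread-squeeze {w = w} o =
  trans (sym (map-∘ w)) (map-id-local (All.map spread-squeeze o))

-- The interval [1⋯ n ]

[1⋯]-∷ʳ : ∀ n → [1⋯ suc n ] ≡ [1⋯ n ] ∷ʳ suc n
[1⋯]-∷ʳ n = sym (applyUpTo-∷ʳ suc n)

[1⋯]-bounds : ∀ n → All (λ x → 1 ≤ x × x ≤ n) [1⋯ n ]
[1⋯]-bounds n = All-applyUpTo⁺ suc n λ i<n → s≤s z≤n , i<n

[1⋯]-unique : ∀ n → Unique [1⋯ n ]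
[1⋯]-unique n = Unique-applyUpTo⁺ suc n λ i<j _ eq → <⇒≢ i<j (suc-injective eq)

-- Induction on n, removing the largest entry. If u = n + 1, the pair stands at the end and
-- `spread u` fixes [n]; otherwise the last entry n + 2 is the spread of n, and the pair lies in the
-- shorter interval.
[1⋯]-split : ∀ n → 1 ≤ u → u ≤ suc n → [1⋯ 2 + n ] ↭ u ∷ suc u ∷ map (spread u) [1⋯ n ]
[1⋯]-split {u} n 1≤u u≤1+n with m≤n⇒m<n∨m≡n u≤1+n
... | inj₂ refl = begin
  [1⋯ 2 + n ]                              ≡⟨ [1⋯]-∷ʳ (suc n) ⟩
  [1⋯ 1 + n ] ∷ʳ (2 + n)                   ≡⟨ cong (_∷ʳ (2 + n)) ([1⋯]-∷ʳ n) ⟩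
  ([1⋯ n ] ∷ʳ (1 + n)) ∷ʳ (2 + n)          ↭⟨ ++⁺ʳ _ (∷↭∷ʳ (1 + n) [1⋯ n ]) ⟨
  (1 + n ∷ [1⋯ n ]) ∷ʳ (2 + n)             ↭⟨ ∷↭∷ʳ (2 + n) (1 + n ∷ [1⋯ n ]) ⟨
  2 + n ∷ 1 + n ∷ [1⋯ n ]                  ↭⟨ swap _ _ ↭-refl ⟩
  1 + n ∷ 2 + n ∷ [1⋯ n ]                  ≡⟨ cong (λ z → 1 + n ∷ 2 + n ∷ z) fixed ⟨
  1 + n ∷ 2 + n ∷ map (spread (suc n)) [1⋯ n ] ∎
  where
  open PermutationReasoning
  fixed : map (spread (suc n)) [1⋯ n ] ≡ [1⋯ n ]
  fixed = map-id-local (All.map (λ b → spread-< (s≤s (proj₂ b))) ([1⋯]-bounds n))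
[1⋯]-split {u} zero 1≤u u≤1+n | inj₁ u<1 = contradiction u<1 (≤⇒≯ 1≤u)
[1⋯]-split {u} (suc n) 1≤u u≤1+n | inj₁ (s≤s u≤n) = begin
  [1⋯ 3 + n ]                                       ≡⟨ [1⋯]-∷ʳ (2 + n) ⟩
  [1⋯ 2 + n ] ∷ʳ (3 + n)                            ↭⟨ ++⁺ʳ _ ([1⋯]-split n 1≤u u≤n) ⟩
  u ∷ suc u ∷ map (spread u) [1⋯ n ] ∷ʳ (3 + n)
    ≡⟨ cong (λ z → u ∷ suc u ∷ map (spread u) [1⋯ n ] ∷ʳ z) (spread-≥ u≤n) ⟨
  u ∷ suc u ∷ map (spread u) [1⋯ n ] ∷ʳ spread u (suc n)
    ≡⟨ cong (λ z → u ∷ suc u ∷ z) (map-++ (spread u) [1⋯ n ] _) ⟨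
  u ∷ suc u ∷ map (spread u) ([1⋯ n ] ∷ʳ suc n)
    ≡⟨ cong (λ z → u ∷ suc u ∷ map (spread u) z) ([1⋯]-∷ʳ n) ⟨
  u ∷ suc u ∷ map (spread u) [1⋯ suc n ] ∎
  where open PermutationReasoning

exchange-[1⋯] : 1 ≤ u → suc u ≤ 2 + n → w ↭ [1⋯ 2 + n ] →
                map (exchange u (suc u)) w ↭ [1⋯ 2 + n ]
exchange-[1⋯] {u} {n} {w} 1≤u (s≤s u≤1+n) w↭ = begin
  map e w                          ↭⟨ ↭-map⁺ e (↭-trans w↭ split) ⟩
  e u ∷ e (suc u) ∷ map e rest
    ≡⟨ cong₂ _∷_ (exchange-left u (suc u))
         (cong₂ _∷_ (exchange-right u (suc u)) (map-id-local fixed)) ⟩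
  suc u ∷ u ∷ rest                 ↭⟨ swap _ _ ↭-refl ⟩
  u ∷ suc u ∷ rest                 ↭⟨ split ⟨
  [1⋯ 2 + n ]                      ∎
  where
  open PermutationReasoning
  e = exchange u (suc u)
  rest = map (spread u) [1⋯ n ]
  split = [1⋯]-split n 1≤u u≤1+n
  off : Outside u x → e x ≡ x
  off (inj₁ x<u) = exchange-other (<⇒≢ x<u) (<⇒≢ (<-trans x<u (n<1+n _)))
  off (inj₂ v<x) = exchange-other (≢-sym (<⇒≢ (<-trans (n<1+n _) v<x))) (≢-sym (<⇒≢ v<x))
  fixed : All (λ x → e x ≡ x) rest
  fixed = All-map⁺ (All.universal (λ x → off (spread-outside u x)) [1⋯ n ])

spread-[1⋯] : 1 ≤ u → u ≤ suc n → w ↭ [1⋯ n ] → u ∷ suc u ∷ map (spread u) w ↭ [1⋯ 2 + n ]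
spread-[1⋯] {u} {n} 1≤u u≤1+n w↭ =
  ↭-trans (prep _ (prep _ (↭-map⁺ (spread u) w↭))) (↭-sym ([1⋯]-split n 1≤u u≤1+n))

-- Cancelling the pair against `[1⋯]-split` leaves w as a rearrangement of the image of `spread u`;
-- both conclusions are read off from that.
squeeze-[1⋯] : 1 ≤ u → u ≤ suc n → u ∷ suc u ∷ w ↭ [1⋯ 2 + n ] →
               map (squeeze u) w ↭ [1⋯ n ] × All (Outside u) w
squeeze-[1⋯] {u} {n} {w} 1≤u u≤1+n uvw↭ =
  ↭-trans (↭-map⁺ (squeeze u) w↭) (↭-reflexive (map-squeeze-spread u [1⋯ n ])) ,
  All-resp-↭ (↭-sym w↭) (All-map⁺ (All.universal (spread-outside u) [1⋯ n ]))
  where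
  w↭ : w ↭ map (spread u) [1⋯ n ]
  w↭ = drop-∷ (drop-∷ (↭-trans uvw↭ ([1⋯]-split n 1≤u u≤1+n)))

↭[1⋯]-bounds : w ↭ [1⋯ n ] → All (λ x → 1 ≤ x × x ≤ n) w
↭[1⋯]-bounds w↭ = All-resp-↭ (↭-sym w↭) ([1⋯]-bounds _)

↭[1⋯]-unique : w ↭ [1⋯ n ] → Unique w
↭[1⋯]-unique w↭ = Unique-resp-↭ (setoid ℕ) (↭⇒↭ₛ (↭-sym w↭)) ([1⋯]-unique _)

↭[1⋯]-length : w ↭ [1⋯ n ] → length w ≡ n
↭[1⋯]-length {n = n} w↭ = trans (↭-length w↭) (length-applyUpTo suc n)

-- Main chain, edges and siblings

Distinct : Tree → Set
Distinct T = Unique (vertices T)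

Unique-++⁻ : ∀ (xs : List ℕ) {ys} → Unique (xs ++ ys) → Unique xs × Unique ys × Disjoint xs ys
Unique-++⁻ []       uys        = [] , uys , λ ()
Unique-++⁻ (x ∷ xs) (px ∷ pxs) =
  let uxs , uys , dis = Unique-++⁻ xs pxs in
  ++⁻ˡ xs px ∷ uxs , uys , λ where
    (here refl , q) → All.lookup (++⁻ʳ xs px) q refl
    (there p   , q) → dis (p , q)

Distinct-node₂⁻ : ∀ {s t} → Distinct (node₂ x s t) →
                  Distinct s × Distinct t × Disjoint (vertices s) (vertices t)
Distinct-node₂⁻ {s = s} (_ ∷ d) = Unique-++⁻ (vertices s) d

root∈ : ∀ T → root T ∈ vertices T
root∈ (leaf _)      = here refl
root∈ (node₁ _ _)   = here refl
root∈ (node₂ _ _ _) = here refl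

p∈ : ∀ T → p T ∈ vertices T
p∈ (leaf _)      = here refl
p∈ (node₁ _ s)   = there (p∈ s)
p∈ (node₂ _ s _) = there (∈-++⁺ˡ (p∈ s))

root≤p : Increasing T → root T ≤ p T
root≤p leaf                  = ≤-refl
root≤p (node₁ x<s s↗)        = ≤-trans (<⇒≤ x<s) (root≤p s↗)
root≤p (node₂ x<s _ _ s↗ _)  = ≤-trans (<⇒≤ x<s) (root≤p s↗)

-- Labels grow strictly along the main chain, so its two ends agree only if it consists of one
-- vertex.
root≡p⇒leaf : Increasing T → root T ≡ x → p T ≡ x → T ≡ leaf x
root≡p⇒leaf leaf                 refl _  = refl
root≡p⇒leaf (node₁ x<s s↗)       refl eq = contradiction (sym eq) (<⇒≢ (<-≤-trans x<s (root≤p s↗)))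
root≡p⇒leaf (node₂ x<s _ _ s↗ _) refl eq = contradiction (sym eq) (<⇒≢ (<-≤-trans x<s (root≤p s↗)))

vertices-mapTree : ∀ f T → vertices (mapTree f T) ≡ map f (vertices T)
vertices-mapTree f (leaf x)      = refl
vertices-mapTree f (node₁ x s)   = cong (f x ∷_) (vertices-mapTree f s)
vertices-mapTree f (node₂ x s t) = cong (f x ∷_)
  (trans (cong₂ _++_ (vertices-mapTree f s) (vertices-mapTree f t))
         (sym (map-++ f (vertices s) (vertices t))))

root-mapTree : ∀ f T → root (mapTree f T) ≡ f (root T)
root-mapTree f (leaf _)      = refl
root-mapTree f (node₁ _ _)   = refl
root-mapTree f (node₂ _ _ _) = refl

p-mapTree : ∀ f T → p (mapTree f T) ≡ f (p T)
p-mapTree f (leaf _)      = refl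
p-mapTree f (node₁ _ s)   = p-mapTree f s
p-mapTree f (node₂ _ s _) = p-mapTree f s

mapTree-inverse : ∀ {f g} T → All (λ x → g (f x) ≡ x) (vertices T) → mapTree g (mapTree f T) ≡ T
mapTree-inverse (leaf x)      (e ∷ _)  = cong leaf e
mapTree-inverse (node₁ x s)   (e ∷ es) = cong₂ node₁ e (mapTree-inverse s es)
mapTree-inverse (node₂ x s t) (e ∷ es) = trans (cong (λ z → node₂ z _ _) e)
  (cong₂ (node₂ x) (mapTree-inverse s (++⁻ˡ (vertices s) es))
                   (mapTree-inverse t (++⁻ʳ (vertices s) es)))

mapTree-exchange-involutive : ∀ u v T → mapTree (exchange u v) (mapTree (exchange u v) T) ≡ T
mapTree-exchange-involutive u v T =
  mapTree-inverse T (All.universal (exchange-involutive u v) (vertices T))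

-- The predicate `P` admits maps that keep the order only on the labels that occur, such as
-- `squeeze u` away from u and u + 1.
mapTree-increasing : ∀ {f} {P : ℕ → Set} → (∀ {x y} → P x → P y → x < y → f x < f y) →
                     All P (vertices T) → Increasing T → Increasing (mapTree f T)
mapTree-increasing mono ps leaf = leaf
mapTree-increasing {node₁ x s} {f} mono (px ∷ ps) (node₁ x<s s↗) =
  node₁ (subst (f x <_) (sym (root-mapTree f s)) (mono px (All.lookup ps (root∈ s)) x<s))
        (mapTree-increasing mono ps s↗)
mapTree-increasing {node₂ x s t} {f} mono (px ∷ ps) (node₂ x<s x<t s<t s↗ t↗) =
  node₂ (subst (f x <_) (sym (root-mapTree f s)) (mono px ps-root x<s))
        (subst (f x <_) (sym (root-mapTree f t)) (mono px pt-root x<t))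
        (subst₂ _<_ (sym (root-mapTree f s)) (sym (root-mapTree f t)) (mono ps-root pt-root s<t))
        (mapTree-increasing mono ps-all s↗) (mapTree-increasing mono pt-all t↗)
  where
  ps-all = ++⁻ˡ (vertices s) ps
  pt-all = ++⁻ʳ (vertices s) ps
  ps-root = All.lookup ps-all (root∈ s)
  pt-root = All.lookup pt-all (root∈ t)

spread-increasing : ∀ u → Increasing T → Increasing (mapTree (spread u) T)
spread-increasing {T} u T↗ =
  mapTree-increasing {P = λ _ → ⊤} (λ _ _ → spread-mono u) (All.universal (λ _ → tt) (vertices T)) T↗

-- The case analysis turns on the edge from u to u + 1: it blocks the exchange of the two labels,
-- and it is present after cases (a) and (b1) and absent after (b2).
Child : ℕ → ℕ → Tree → Set
Child u v (leaf _)      = ⊥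
Child u v (node₁ x s)   = (x ≡ u × root s ≡ v) ⊎ Child u v s
Child u v (node₂ x s t) = (x ≡ u × (root s ≡ v ⊎ root t ≡ v)) ⊎ Child u v s ⊎ Child u v t

child? : ∀ u v T → Dec (Child u v T)
child? u v (leaf _)      = no λ ()
child? u v (node₁ x s)   = (x ≟ u ×-dec root s ≟ v) ⊎-dec child? u v s
child? u v (node₂ x s t) =
  (x ≟ u ×-dec (root s ≟ v ⊎-dec root t ≟ v)) ⊎-dec child? u v s ⊎-dec child? u v t

Child-< : Increasing T → Child u v T → u < v
Child-< (node₁ x<s _)          (inj₁ (refl , refl))      = x<s
Child-< (node₁ _ s↗)           (inj₂ c)                  = Child-< s↗ c
Child-< (node₂ x<s _ _ _ _)    (inj₁ (refl , inj₁ refl)) = x<s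
Child-< (node₂ _ x<t _ _ _)    (inj₁ (refl , inj₂ refl)) = x<t
Child-< (node₂ _ _ _ s↗ _)     (inj₂ (inj₁ c))           = Child-< s↗ c
Child-< (node₂ _ _ _ _ t↗)     (inj₂ (inj₂ c))           = Child-< t↗ c

Child-∈ˡ : ∀ T → Child u v T → u ∈ vertices T
Child-∈ˡ (node₁ x s)   (inj₁ (refl , _)) = here refl
Child-∈ˡ (node₁ x s)   (inj₂ c)          = there (Child-∈ˡ s c)
Child-∈ˡ (node₂ x s t) (inj₁ (refl , _)) = here refl
Child-∈ˡ (node₂ x s t) (inj₂ (inj₁ c))   = there (∈-++⁺ˡ (Child-∈ˡ s c))
Child-∈ˡ (node₂ x s t) (inj₂ (inj₂ c))   = there (∈-++⁺ʳ (vertices s) (Child-∈ˡ t c))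

Child-∈ʳ : ∀ T → Child u v T → v ∈ vertices T
Child-∈ʳ (node₁ x s)   (inj₁ (_ , refl))      = there (root∈ s)
Child-∈ʳ (node₁ x s)   (inj₂ c)               = there (Child-∈ʳ s c)
Child-∈ʳ (node₂ x s t) (inj₁ (_ , inj₁ refl)) = there (∈-++⁺ˡ (root∈ s))
Child-∈ʳ (node₂ x s t) (inj₁ (_ , inj₂ refl)) = there (∈-++⁺ʳ (vertices s) (root∈ t))
Child-∈ʳ (node₂ x s t) (inj₂ (inj₁ c))        = there (∈-++⁺ˡ (Child-∈ʳ s c))
Child-∈ʳ (node₂ x s t) (inj₂ (inj₂ c))        = there (∈-++⁺ʳ (vertices s) (Child-∈ʳ t c))

Siblings-∈ : ∀ T → Siblings u v T → u ∈ vertices T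
Siblings-∈ (node₁ x s)   sib                              = there (Siblings-∈ s sib)
Siblings-∈ (node₂ x s t) (inj₁ (refl , _))                = there (∈-++⁺ˡ (root∈ s))
Siblings-∈ (node₂ x s t) (inj₂ (inj₁ (_ , refl)))         = there (∈-++⁺ʳ (vertices s) (root∈ t))
Siblings-∈ (node₂ x s t) (inj₂ (inj₂ (inj₁ sib)))         = there (∈-++⁺ˡ (Siblings-∈ s sib))
Siblings-∈ (node₂ x s t) (inj₂ (inj₂ (inj₂ sib)))         = there (∈-++⁺ʳ (vertices s) (Siblings-∈ t sib))

Siblings-sym : ∀ T → Siblings u v T → Siblings v u T
Siblings-sym (node₁ x s)   sib                      = Siblings-sym s sib
Siblings-sym (node₂ x s t) (inj₁ eqs)               = inj₂ (inj₁ eqs)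
Siblings-sym (node₂ x s t) (inj₂ (inj₁ eqs))        = inj₁ eqs
Siblings-sym (node₂ x s t) (inj₂ (inj₂ (inj₁ sib))) = inj₂ (inj₂ (inj₁ (Siblings-sym s sib)))
Siblings-sym (node₂ x s t) (inj₂ (inj₂ (inj₂ sib))) = inj₂ (inj₂ (inj₂ (Siblings-sym t sib)))

-- The main chain ends at a leaf, and since labels are distinct the same label cannot reappear as an
-- inner vertex elsewhere.
p-no-Child : Increasing T → Distinct T → p T ≡ u → ¬ Child u v T
p-no-Child (node₁ x<s s↗) _ refl (inj₁ (x≡p , _)) = <⇒≢ (<-≤-trans x<s (root≤p s↗)) x≡p
p-no-Child (node₁ x<s s↗) (_ ∷ d) refl (inj₂ c) = p-no-Child s↗ d refl c
p-no-Child (node₂ x<s _ _ s↗ _) _ refl (inj₁ (x≡p , _)) = <⇒≢ (<-≤-trans x<s (root≤p s↗)) x≡p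
p-no-Child (node₂ _ _ _ s↗ _) d refl (inj₂ (inj₁ c)) =
  p-no-Child s↗ (proj₁ (Distinct-node₂⁻ d)) refl c
p-no-Child {node₂ x s t} _ d refl (inj₂ (inj₂ c)) =
  proj₂ (proj₂ (Distinct-node₂⁻ d)) (p∈ s , Child-∈ˡ t c)

-- The chain always enters the smaller child, so a sibling of its last vertex is larger; distinct
-- labels keep that vertex out of the other subtrees.
p-no-smaller-sibling : Increasing T → Distinct T → p T ≡ v → u < v → ¬ Siblings u v T
p-no-smaller-sibling (node₁ _ s↗) (_ ∷ d) refl u<v sib = p-no-smaller-sibling s↗ d refl u<v sib
p-no-smaller-sibling {node₂ x s t} _ d refl _ (inj₁ (_ , eq)) =
  proj₂ (proj₂ (Distinct-node₂⁻ d)) (p∈ s , subst (_∈ vertices t) eq (root∈ t))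
p-no-smaller-sibling (node₂ _ _ s<t _ _) _ refl u<v (inj₂ (inj₁ (eq , refl))) =
  <-asym u<v (subst (_< _) eq s<t)
p-no-smaller-sibling (node₂ _ _ _ s↗ _) d refl u<v (inj₂ (inj₂ (inj₁ sib))) =
  p-no-smaller-sibling s↗ (proj₁ (Distinct-node₂⁻ d)) refl u<v sib
p-no-smaller-sibling {node₂ x s t} _ d refl _ (inj₂ (inj₂ (inj₂ sib))) =
  proj₂ (proj₂ (Distinct-node₂⁻ d)) (p∈ s , Siblings-∈ t (Siblings-sym t sib))

exchange-root : ∀ u v T → root (mapTree (exchange u v) T) ≡ u → root T ≡ v
exchange-root u v T eq = exchange≡left u v (trans (sym (root-mapTree _ T)) eq)

exchange-root′ : ∀ u v T → root (mapTree (exchange u v) T) ≡ v → root T ≡ u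
exchange-root′ u v T eq = exchange≡right u v (trans (sym (root-mapTree _ T)) eq)

-- Together with `Child-<` this shows that relabelling an increasing tree never creates an edge from
-- u to u + 1: it would come from an edge from u + 1 to u.
Child-exchange : ∀ T → Child u v (mapTree (exchange u v) T) → Child v u T
Child-exchange {u} {v} (node₁ x s) (inj₁ (eq , eq′)) =
  inj₁ (exchange≡left u v eq , exchange-root′ u v s eq′)
Child-exchange (node₁ x s) (inj₂ c) = inj₂ (Child-exchange s c)
Child-exchange {u} {v} (node₂ x s t) (inj₁ (eq , eqs)) =
  inj₁ (exchange≡left u v eq , Sum.map (exchange-root′ u v s) (exchange-root′ u v t) eqs)
Child-exchange (node₂ x s t) (inj₂ (inj₁ c)) = inj₂ (inj₁ (Child-exchange s c))
Child-exchange (node₂ x s t) (inj₂ (inj₂ c)) = inj₂ (inj₂ (Child-exchange t c))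

Siblings-exchange : ∀ T → Siblings u v (mapTree (exchange u v) T) → Siblings u v T
Siblings-exchange (node₁ x s) sib = Siblings-exchange s sib
Siblings-exchange {u} {v} (node₂ x s t) (inj₁ (eq , eq′)) =
  inj₂ (inj₁ (exchange-root u v s eq , exchange-root′ u v t eq′))
Siblings-exchange {u} {v} (node₂ x s t) (inj₂ (inj₁ (eq , eq′))) =
  inj₁ (exchange-root′ u v s eq , exchange-root u v t eq′)
Siblings-exchange (node₂ x s t) (inj₂ (inj₂ (inj₁ sib))) = inj₂ (inj₂ (inj₁ (Siblings-exchange s sib)))
Siblings-exchange (node₂ x s t) (inj₂ (inj₂ (inj₂ sib))) = inj₂ (inj₂ (inj₂ (Siblings-exchange t sib)))

-- `Increasing` compares only parents with children and siblings with each other. By `exchange-mono`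
-- each comparison survives unless it is between u and u + 1, and the two hypotheses exclude those.
exchange-increasing : Increasing T → ¬ Child u (suc u) T → ¬ Siblings u (suc u) T →
                      Increasing (mapTree (exchange u (suc u)) T)
exchange-increasing leaf _ _ = leaf
exchange-increasing {node₁ x s} {u} (node₁ x<s s↗) ¬c ¬sib =
  node₁ (subst (_ <_) (sym (root-mapTree _ s)) (exchange-mono x<s (¬c ∘ inj₁)))
        (exchange-increasing s↗ (¬c ∘ inj₂) ¬sib)
exchange-increasing {node₂ x s t} {u} (node₂ x<s x<t s<t s↗ t↗) ¬c ¬sib =
  node₂ (subst (_ <_) (sym (root-mapTree _ s))
          (exchange-mono x<s λ (eq , eq′) → ¬c (inj₁ (eq , inj₁ eq′))))
        (subst (_ <_) (sym (root-mapTree _ t))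
          (exchange-mono x<t λ (eq , eq′) → ¬c (inj₁ (eq , inj₂ eq′))))
        (subst₂ _<_ (sym (root-mapTree _ s)) (sym (root-mapTree _ t)) (exchange-mono s<t (¬sib ∘ inj₁)))
        (exchange-increasing s↗ (¬c ∘ inj₂ ∘ inj₁) (¬sib ∘ inj₂ ∘ inj₂ ∘ inj₁))
        (exchange-increasing t↗ (¬c ∘ inj₂ ∘ inj₂) (¬sib ∘ inj₂ ∘ inj₂ ∘ inj₂))

-- The graphs of `insert` and `rearrange` with v = u + 1

data Ins (u : ℕ) : Tree → Tree → Set where
  here  : suc u < root S → Ins u S (node₂ u (leaf (suc u)) S)
  node₁ : x < u → Ins u S T → Ins u (node₁ x S) (node₁ x T)
  -- The order of the siblings before insertion is recorded, because the result does not show it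
  -- when u becomes the first child of x. It also separates this case from `two` below.
  node₂ : ∀ {t} → x < u → root S < root t → Ins u S T → Ins u (node₂ x S t) (node₂ x T t)

data Rear (u : ℕ) : Tree → Tree → Set where
  none  : Rear u (node₂ x (leaf u) (leaf (suc u))) (node₁ x (node₁ u (leaf (suc u))))
  one   : ∀ {A} → suc u < root A →
          Rear u (node₂ x (leaf u) (node₁ (suc u) A)) (node₂ x (node₁ u (leaf (suc u))) A)
  two   : ∀ {A B} → suc u < root A → root A < root B →
          Rear u (node₂ x (leaf u) (node₂ (suc u) A B)) (node₂ x (node₂ u (leaf (suc u)) B) A)
  node₁ : Rear u S T → Rear u (node₁ x S) (node₁ x T)
  node₂ : ∀ {t} → Rear u S T → Rear u (node₂ x S t) (node₂ x T t)

Ins⇒insert : Ins u S T → insert u (suc u) S ≡ just T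
Ins⇒insert {u} {S} (here v<S) with suc u <? root S
... | yes _   = refl
... | no  v≮S = contradiction v<S v≮S
Ins⇒insert {u} (node₁ {x = x} x<u i) with suc u <? x
... | yes v<x = contradiction v<x (<-asym (<-trans x<u (n<1+n _)))
... | no  _   = cong (Maybe.map _) (Ins⇒insert i)
Ins⇒insert {u} (node₂ {x = x} x<u _ i) with suc u <? x
... | yes v<x = contradiction v<x (<-asym (<-trans x<u (n<1+n _)))
... | no  _   = cong (Maybe.map _) (Ins⇒insert i)

-- The labels on the chain avoid u and u + 1, so each is below u or a possible m; as the last one
-- exceeds u + 1, the descent meets m before it runs out.
Ins-total : Increasing S → All (Outside u) (vertices S) → suc u < p S → ∃ (Ins u S)
Ins-total {leaf _}    _ _              v<p = _ , here v<p
Ins-total {node₁ _ _} _ (inj₂ v<x ∷ _) _   = _ , here v<x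
Ins-total {node₂ _ _ _} _ (inj₂ v<x ∷ _) _ = _ , here v<x
Ins-total (node₁ _ s↗) (inj₁ x<u ∷ o) v<p = _ , node₁ x<u (proj₂ (Ins-total s↗ o v<p))
Ins-total {node₂ x s t} (node₂ _ _ s<t s↗ _) (inj₁ x<u ∷ o) v<p =
  _ , node₂ x<u s<t (proj₂ (Ins-total s↗ (++⁻ˡ (vertices s) o) v<p))

-- Insertion changes the root only when m is the root, and then u < m replaces it. Hence a first
-- child stays the smaller one.
Ins-root-≤ : Ins u S T → root T ≤ root S
Ins-root-≤ (here v<S)    = <⇒≤ (<-trans (n<1+n _) v<S)
Ins-root-≤ (node₁ _ _)   = ≤-refl
Ins-root-≤ (node₂ _ _ _) = ≤-refl

Ins-root-> : x < u → x < root S → Ins u S T → x < root T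
Ins-root-> x<u x<S (here _)      = x<u
Ins-root-> x<u x<S (node₁ _ _)   = x<S
Ins-root-> x<u x<S (node₂ _ _ _) = x<S

Ins-increasing : Increasing S → Ins u S T → Increasing T
Ins-increasing S↗ (here v<S) = node₂ (n<1+n _) (<-trans (n<1+n _) v<S) v<S leaf S↗
Ins-increasing (node₁ x<s s↗) (node₁ x<u i) = node₁ (Ins-root-> x<u x<s i) (Ins-increasing s↗ i)
Ins-increasing (node₂ x<s x<t s<t s↗ t↗) (node₂ x<u _ i) =
  node₂ (Ins-root-> x<u x<s i) x<t (≤-<-trans (Ins-root-≤ i) s<t) (Ins-increasing s↗ i) t↗

Ins-increasing⁻ : Increasing T → Ins u S T → Increasing S
Ins-increasing⁻ (node₂ _ _ _ _ S↗) (here _) = S↗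
Ins-increasing⁻ (node₁ x<s s↗) (node₁ _ i) =
  node₁ (<-≤-trans x<s (Ins-root-≤ i)) (Ins-increasing⁻ s↗ i)
-- The sibling order in S is taken from `Ins`, since in T the first root may have been lowered to u.
Ins-increasing⁻ (node₂ x<s x<t _ s↗ t↗) (node₂ _ s<t i) =
  node₂ (<-≤-trans x<s (Ins-root-≤ i)) x<t s<t (Ins-increasing⁻ s↗ i) t↗

Ins-vertices : Ins u S T → vertices T ↭ u ∷ suc u ∷ vertices S
Ins-vertices (here _) = ↭-refl
Ins-vertices {u} (node₁ {x = x} _ i) =
  ↭-trans (prep x (Ins-vertices i)) (shifts (x ∷ []) (u ∷ suc u ∷ []))
Ins-vertices {u} (node₂ {x = x} _ _ i) =
  ↭-trans (prep x (++⁺ʳ _ (Ins-vertices i))) (shifts (x ∷ []) (u ∷ suc u ∷ []))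

Ins-∈ : Ins u S T → root S ∈ vertices T
Ins-∈ {S = S} i = ∈-resp-↭ (↭-sym (Ins-vertices i)) (there (there (root∈ S)))

Ins-p : Ins u S T → p T ≡ suc u
Ins-p (here _)      = refl
Ins-p (node₁ _ i)   = Ins-p i
Ins-p (node₂ _ _ i) = Ins-p i

Ins-p⁻ : Increasing S → Ins u S T → suc u < p S
Ins-p⁻ S↗ (here v<S) = <-≤-trans v<S (root≤p S↗)
Ins-p⁻ (node₁ _ s↗) (node₁ _ i) = Ins-p⁻ s↗ i
Ins-p⁻ (node₂ _ _ _ s↗ _) (node₂ _ _ i) = Ins-p⁻ s↗ i

Ins-Child : Ins u S T → Child u (suc u) T
Ins-Child (here _)      = inj₁ (refl , inj₁ refl)
Ins-Child (node₁ _ i)   = inj₂ (Ins-Child i)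
Ins-Child (node₂ _ _ i) = inj₂ (inj₁ (Ins-Child i))

Ins-injective : Ins u S T → Ins u S′ T → S ≡ S′
Ins-injective (here _)      (here _)       = refl
Ins-injective (node₁ _ i)   (node₁ _ i′)   = cong (node₁ _) (Ins-injective i i′)
Ins-injective (node₂ _ _ i) (node₂ _ _ i′) = cong (λ s → node₂ _ s _) (Ins-injective i i′)

Rear-root : Rear u S T → root T ≡ root S
Rear-root none      = refl
Rear-root (one _)   = refl
Rear-root (two _ _) = refl
Rear-root (node₁ _) = refl
Rear-root (node₂ _) = refl

-- The parent j of u lies in S, so the root of S is j or an ancestor of j.
Rear-root-< : Increasing S → Rear u S T → root S < u
Rear-root-< (node₂ x<u _ _ _ _) none      = x<u
Rear-root-< (node₂ x<u _ _ _ _) (one _)   = x<u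
Rear-root-< (node₂ x<u _ _ _ _) (two _ _) = x<u
Rear-root-< (node₁ x<s s↗) (node₁ r) = <-trans x<s (Rear-root-< s↗ r)
Rear-root-< (node₂ x<s _ _ s↗ _) (node₂ r) = <-trans x<s (Rear-root-< s↗ r)

Rear⇒rearrange : Increasing S → Rear u S T → rearrange u (suc u) S ≡ just T
Rear⇒rearrange {u = u} _ none with u ≟ u ×-dec suc u ≟ suc u
... | yes _ = refl
... | no ¬e = contradiction (refl , refl) ¬e
Rear⇒rearrange {u = u} _ (one _) with u ≟ u ×-dec suc u ≟ suc u
... | yes _ = refl
... | no ¬e = contradiction (refl , refl) ¬e
Rear⇒rearrange {u = u} _ (two _ _) with u ≟ u ×-dec suc u ≟ suc u
... | yes _ = refl
... | no ¬e = contradiction (refl , refl) ¬e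
Rear⇒rearrange (node₁ _ s↗) (node₁ r) = cong (Maybe.map _) (Rear⇒rearrange s↗ r)
Rear⇒rearrange {node₂ x s t} {u} (node₂ _ _ _ s↗ _) (node₂ r) with root s ≟ u ×-dec root t ≟ suc u
-- Above j the chain subtree still contains j, so its root is smaller than u and the test for the
-- siblings cannot succeed too early.
... | yes (s≡u , _) = contradiction s≡u (<⇒≢ (Rear-root-< s↗ r))
... | no _ = cong (Maybe.map _) (Rear⇒rearrange s↗ r)

-- The main chain ends at u, so the first child of j is the leaf u, and the shape of the subtree at
-- u + 1 selects the rule. The reverse listing contradicts the order of siblings, and siblings in a
-- second subtree contradict distinctness.
Rear-total : Increasing S → Distinct S → p S ≡ u → Siblings u (suc u) S → ∃ (Rear u S)
Rear-total (node₁ _ s↗) (_ ∷ d) p≡u sib = _ , node₁ (proj₂ (Rear-total s↗ d p≡u sib))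
Rear-total {node₂ _ _ (leaf _)} (node₂ _ _ _ s↗ _) _ p≡u (inj₁ (s≡u , refl))
  with refl ← root≡p⇒leaf s↗ s≡u p≡u = _ , none
Rear-total {node₂ _ _ (node₁ _ _)} (node₂ _ _ _ s↗ (node₁ v<A _)) _ p≡u (inj₁ (s≡u , refl))
  with refl ← root≡p⇒leaf s↗ s≡u p≡u = _ , one v<A
Rear-total {node₂ _ _ (node₂ _ _ _)} (node₂ _ _ _ s↗ (node₂ v<A _ A<B _ _)) _ p≡u (inj₁ (s≡u , refl))
  with refl ← root≡p⇒leaf s↗ s≡u p≡u = _ , two v<A A<B
Rear-total {u = u} (node₂ _ _ s<t _ _) _ _ (inj₂ (inj₁ (eq , eq′))) =
  contradiction (subst₂ _<_ eq eq′ s<t) (<-asym (n<1+n u))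
Rear-total (node₂ _ _ _ s↗ _) d p≡u (inj₂ (inj₂ (inj₁ sib))) =
  _ , node₂ (proj₂ (Rear-total s↗ (proj₁ (Distinct-node₂⁻ d)) p≡u sib))
Rear-total {node₂ x s t} _ d refl (inj₂ (inj₂ (inj₂ sib))) =
  ⊥-elim (proj₂ (proj₂ (Distinct-node₂⁻ d)) (p∈ s , Siblings-∈ t sib))

Rear-increasing : Increasing S → Rear u S T → Increasing T
Rear-increasing (node₂ x<u _ u<v _ _) none = node₁ x<u (node₁ u<v leaf)
Rear-increasing (node₂ x<u x<v u<v _ (node₁ v<A A↗)) (one _) =
  node₂ x<u (<-trans x<v v<A) (<-trans u<v v<A) (node₁ u<v leaf) A↗
Rear-increasing (node₂ x<u x<v u<v _ (node₂ v<A v<B _ A↗ B↗)) (two _ _) =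
  node₂ x<u (<-trans x<v v<A) (<-trans u<v v<A) (node₂ u<v (<-trans u<v v<B) v<B leaf B↗) A↗
Rear-increasing (node₁ x<s s↗) (node₁ r) =
  node₁ (subst (_ <_) (sym (Rear-root r)) x<s) (Rear-increasing s↗ r)
Rear-increasing (node₂ x<s x<t s<t s↗ t↗) (node₂ r) =
  node₂ (subst (_ <_) (sym (Rear-root r)) x<s) x<t (subst (_< _) (sym (Rear-root r)) s<t)
        (Rear-increasing s↗ r) t↗

Rear-increasing⁻ : Increasing T → Rear u S T → Increasing S
Rear-increasing⁻ (node₁ x<u (node₁ u<v _)) none = node₂ x<u (<-trans x<u u<v) u<v leaf leaf
Rear-increasing⁻ (node₂ x<u _ _ (node₁ u<v _) A↗) (one v<A) =
  node₂ x<u (<-trans x<u u<v) u<v leaf (node₁ v<A A↗)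
Rear-increasing⁻ (node₂ x<u _ _ (node₂ u<v _ v<B _ B↗) A↗) (two v<A A<B) =
  node₂ x<u (<-trans x<u u<v) u<v leaf (node₂ v<A v<B A<B A↗ B↗)
Rear-increasing⁻ (node₁ x<s s↗) (node₁ r) =
  node₁ (subst (_ <_) (Rear-root r) x<s) (Rear-increasing⁻ s↗ r)
Rear-increasing⁻ (node₂ x<s x<t s<t s↗ t↗) (node₂ r) =
  node₂ (subst (_ <_) (Rear-root r) x<s) x<t (subst (_< _) (Rear-root r) s<t)
        (Rear-increasing⁻ s↗ r) t↗

Rear-vertices : Rear u S T → vertices T ↭ vertices S
Rear-vertices none                = ↭-refl
Rear-vertices (one _)             = ↭-refl
Rear-vertices (two {A = A} {B} _ _) = prep _ (prep _ (prep _ (++-comm (vertices B) (vertices A))))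
Rear-vertices (node₁ r)           = prep _ (Rear-vertices r)
Rear-vertices (node₂ r)           = prep _ (++⁺ʳ _ (Rear-vertices r))

Rear-p : Rear u S T → p T ≡ suc u
Rear-p none      = refl
Rear-p (one _)   = refl
Rear-p (two _ _) = refl
Rear-p (node₁ r) = Rear-p r
Rear-p (node₂ r) = Rear-p r

Rear-p⁻ : Rear u S T → p S ≡ u
Rear-p⁻ none      = refl
Rear-p⁻ (one _)   = refl
Rear-p⁻ (two _ _) = refl
Rear-p⁻ (node₁ r) = Rear-p⁻ r
Rear-p⁻ (node₂ r) = Rear-p⁻ r

Rear-Siblings : Rear u S T → Siblings u (suc u) S
Rear-Siblings none      = inj₁ (refl , refl)
Rear-Siblings (one _)   = inj₁ (refl , refl)
Rear-Siblings (two _ _) = inj₁ (refl , refl)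
Rear-Siblings (node₁ r) = Rear-Siblings r
Rear-Siblings (node₂ r) = inj₂ (inj₂ (inj₁ (Rear-Siblings r)))

Rear-Child : Rear u S T → Child u (suc u) T
Rear-Child none      = inj₂ (inj₁ (refl , refl))
Rear-Child (one _)   = inj₂ (inj₁ (inj₁ (refl , refl)))
Rear-Child (two _ _) = inj₂ (inj₁ (inj₁ (refl , inj₁ refl)))
Rear-Child (node₁ r) = inj₂ (Rear-Child r)
Rear-Child (node₂ r) = inj₂ (inj₁ (Rear-Child r))

Rear-injective : Rear u S T → Rear u S′ T → S ≡ S′
Rear-injective none      none       = refl
Rear-injective (one _)   (one _)    = refl
Rear-injective (two _ _) (two _ _)  = refl
-- Descending past u would make the single vertex u + 1 the output of a further step, and no rule
-- yields a leaf.
Rear-injective none      (node₁ (node₁ ()))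
Rear-injective (one _)   (node₂ (node₁ ()))
Rear-injective (two _ _) (node₂ (node₂ ()))
Rear-injective (node₁ (node₁ ())) none
Rear-injective (node₂ (node₁ ())) (one _)
Rear-injective (node₂ (node₂ ())) (two _ _)
Rear-injective (node₁ r) (node₁ r′) = cong (node₁ _) (Rear-injective r r′)
Rear-injective (node₂ r) (node₂ r′) = cong (λ s → node₂ _ s _) (Rear-injective r r′)

-- Most overlaps would require one of the relations to yield a leaf. The remaining one has u with
-- second child B under a parent with second child A: insertion gives B the smaller root,
-- rearrangement gives it to A.
Ins-Rear-disjoint : Ins u S T → ¬ Rear u S′ T
Ins-Rear-disjoint (node₁ _ (node₁ _ ())) none
Ins-Rear-disjoint (node₂ _ _ (node₁ _ ())) (one _)
Ins-Rear-disjoint (node₂ _ B<A (here _)) (two _ A<B) = <-asym B<A A<B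
Ins-Rear-disjoint (here _) (node₂ ())
Ins-Rear-disjoint (node₁ _ i) (node₁ r) = Ins-Rear-disjoint i r
Ins-Rear-disjoint (node₂ _ _ i) (node₂ r) = Ins-Rear-disjoint i r

Ins-root-≤u : Ins u S T → root T ≤ u
Ins-root-≤u (here _)        = ≤-refl
Ins-root-≤u (node₁ x<u _)   = <⇒≤ x<u
Ins-root-≤u (node₂ x<u _ _) = <⇒≤ x<u

-- The three shapes of a tree whose main chain ends with the edge (u, u + 1);
-- the first one is excluded by counting vertices.
ChainEdge : ℕ → Tree → Set
ChainEdge u T = T ≡ node₁ u (leaf (suc u)) ⊎ (∃ λ S → Ins u S T) ⊎ (∃ λ S → Rear u S T)

-- The argument climbs from u to the root. A second child of u gives an insertion at once; if u + 1
-- is the only child, the parent of u gives `none` or `one`. Further up both relations extend,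
-- except for the conflict of orders settled by `inserted`.
Child⇒ChainEdge : Increasing T → Distinct T → p T ≡ suc u → Child u (suc u) T → ChainEdge u T
Child⇒ChainEdge (node₁ _ s↗) _ p≡v (inj₁ (refl , s≡v)) =
  inj₁ (cong (node₁ _) (root≡p⇒leaf s↗ s≡v p≡v))
Child⇒ChainEdge (node₁ x<s s↗) (_ ∷ d) p≡v (inj₂ c) with Child⇒ChainEdge s↗ d p≡v c
... | inj₁ refl           = inj₂ (inj₂ (_ , none))
... | inj₂ (inj₁ (_ , i)) = inj₂ (inj₁ (_ , node₁ (<-≤-trans x<s (Ins-root-≤u i)) i))
... | inj₂ (inj₂ (_ , r)) = inj₂ (inj₂ (_ , node₁ r))
Child⇒ChainEdge {node₂ x s t} {u} (node₂ x<s _ s<t s↗ _) d p≡v c = side c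
  where
  d-s = proj₁ (Distinct-node₂⁻ d)
  dis = proj₂ (proj₂ (Distinct-node₂⁻ d))

  v∉t : ¬ suc u ∈ vertices t
  v∉t v∈t = dis (p∈ s , subst (_∈ vertices t) (sym p≡v) v∈t)

  u<t⇒v<t : u < root t → suc u < root t
  u<t⇒v<t u<t = <⇒suc< u<t λ t≡v → v∉t (subst (_∈ vertices t) t≡v (root∈ t))

  -- If S has the smaller root, the insertion extends upwards. If it has the larger one, the
  -- insertion changed the root, so it is `here` and the tree is a rearrangement of type `two`.
  inserted : Ins u S s → root S ≢ root t → ChainEdge u (node₂ x s t)
  inserted {S} i S≢t with <-cmp (root S) (root t)
  inserted i           S≢t | tri< S<t _ _ = inj₂ (inj₁ (_ , node₂ (<-≤-trans x<s (Ins-root-≤u i)) S<t i))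
  inserted i           S≢t | tri≈ _ S≡t _ = contradiction S≡t S≢t
  inserted (here _)    S≢t | tri> _ _ t<S = inj₂ (inj₂ (_ , two (u<t⇒v<t s<t) t<S))
  inserted (node₁ _ _) S≢t | tri> _ _ t<S = contradiction s<t (<-asym t<S)
  inserted (node₂ _ _ _) S≢t | tri> _ _ t<S = contradiction s<t (<-asym t<S)

  side : Child u (suc u) (node₂ x s t) → ChainEdge u (node₂ x s t)
  side (inj₁ (refl , inj₁ s≡v)) with refl ← root≡p⇒leaf s↗ s≡v p≡v = inj₂ (inj₁ (_ , here s<t))
  side (inj₁ (_ , inj₂ t≡v)) = contradiction (subst (_∈ vertices t) t≡v (root∈ t)) v∉t
  side (inj₂ (inj₂ c)) = contradiction (Child-∈ʳ t c) v∉t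
  side (inj₂ (inj₁ c)) with Child⇒ChainEdge s↗ d-s p≡v c
  ... | inj₁ refl           = inj₂ (inj₂ (_ , one (u<t⇒v<t s<t)))
  ... | inj₂ (inj₁ (_ , i)) = inserted i λ S≡t →
    dis (Ins-∈ i , subst (_∈ vertices t) (sym S≡t) (root∈ t))
  ... | inj₂ (inj₂ (_ , r)) = inj₂ (inj₂ (_ , node₂ r))

-- The tree step of case (b)

data Unex (u : ℕ) (S T : Tree) : Set where
  rear    : Rear u S T → Unex u S T
  relabel : ¬ Siblings u (suc u) S → T ≡ mapTree (exchange u (suc u)) S → Unex u S T

Unex⇒unexchange : Increasing S → Unex u S T → unexchange u (suc u) S ≡ just T
Unex⇒unexchange {S} {u} S↗ (rear r) with siblings? u (suc u) S
... | yes _   = Rear⇒rearrange S↗ r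
... | no ¬sib = contradiction (Rear-Siblings r) ¬sib
Unex⇒unexchange {S} {u} S↗ (relabel ¬sib refl) with siblings? u (suc u) S
... | yes sib = contradiction sib ¬sib
... | no _    = refl

-- Alternating words

module _ {f : ℕ → ℕ} {P : ℕ → Set} (mono : ∀ {x y} → P x → P y → x < y → f x < f y) where

  map-alternating↓ : All P w → Alternating↓ w → Alternating↓ (map f w)
  map-alternating↑ : All P w → Alternating↑ w → Alternating↑ (map f w)

  map-alternating↓ _              []          = []
  map-alternating↓ _              [-]         = [-]
  map-alternating↓ (px ∷ py ∷ ps) (x>y ∷ alt) = mono py px x>y ∷ map-alternating↑ (py ∷ ps) alt

  map-alternating↑ _              [-]         = [-]
  map-alternating↑ (px ∷ py ∷ ps) (x<y ∷ alt) = mono px py x<y ∷ map-alternating↓ (py ∷ ps) alt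

exchange-below : y < u → exchange u (suc u) y ≡ y
exchange-below y<u = exchange-other (<⇒≢ y<u) (<⇒≢ (<-trans y<u (n<1+n _)))

-- The entry after the head is below u, and u does not recur in the tail, so the exchange keeps all
-- comparisons there; the new head u + 1 is larger still.
raise-alternating : Unique (u ∷ y ∷ w) → Alternating↓ (u ∷ y ∷ w) →
                    Alternating↓ (map (exchange u (suc u)) (u ∷ y ∷ w))
raise-alternating {u} (u∉ ∷ _) (y<u ∷ alt) =
  subst₂ _<_ (sym (exchange-below y<u)) (sym (exchange-left u (suc u))) (<-trans y<u (n<1+n u)) ∷
  map-alternating↑ (λ u≢x _ x<y → exchange-mono x<y λ (x≡u , _) → u≢x (sym x≡u)) u∉ alt

-- The head drops to u, and y < u, the condition of case (b), keeps it above y. The tail lacks u +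
-- 1, so its comparisons survive.
lower-alternating : y < u → Unique (suc u ∷ y ∷ w) → Alternating↓ (suc u ∷ y ∷ w) →
                    Alternating↓ (map (exchange u (suc u)) (suc u ∷ y ∷ w))
lower-alternating {u = u} y<u (v∉ ∷ _) (_ ∷ alt) =
  subst₂ _<_ (sym (exchange-below y<u)) (sym (exchange-right u (suc u))) y<u ∷
  map-alternating↑ (λ _ v≢y x<y → exchange-mono x<y λ (_ , y≡v) → v≢y (sym y≡v)) v∉ alt

-- Membership in 𝒜 n k and in 𝒯 n k

IsA : ℕ → ℕ → List ℕ → Set
IsA n k w = w ↭ [1⋯ n ] × Alternating↓ w × head w ≡ just k

IsT : ℕ → ℕ → Tree → Set
IsT n k T = vertices T ↭ [1⋯ n ] × Increasing T × p T ≡ k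

IsA-bounds : IsA n k w → 1 ≤ k × k ≤ n
IsA-bounds {w = _ ∷ _} (w↭ , _ , refl) = All.head (↭[1⋯]-bounds w↭)

IsT-distinct : IsT n k T → Distinct T
IsT-distinct (T↭ , _) = ↭[1⋯]-unique T↭

IsT-bounds : IsT n k T → 1 ≤ k × k ≤ n
IsT-bounds {T = T} (T↭ , _ , refl) = All.lookup (↭[1⋯]-bounds T↭) (p∈ T)

-- The bound u ≤ i expresses π₃ > k: spreading turns i into i + 2, which exceeds u + 1.
IsA-ins : 1 ≤ u → u ≤ i → IsA (suc n) i w →
          IsA (3 + n) (suc u) (suc u ∷ u ∷ map (spread u) w)
IsA-ins {u} {w = i ∷ w} 1≤u u≤i a@(w↭ , alt , refl) =
  ↭-trans (swap _ _ ↭-refl) (spread-[1⋯] 1≤u (m≤n⇒m≤1+n (≤-trans u≤i (proj₂ (IsA-bounds a)))) w↭) ,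
  n<1+n u ∷
  (subst (u <_) (sym (spread-≥ u≤i)) (m<n⇒m<1+n (s≤s u≤i)) ∷
   map-alternating↓ {P = λ _ → ⊤} (λ _ _ → spread-mono u) (All.universal (λ _ → tt) (i ∷ w)) alt) ,
  refl

IsA-exchange : 1 ≤ u → u < 3 + n → IsA (3 + n) u w →
               IsA (3 + n) (suc u) (map (exchange u (suc u)) w)
IsA-exchange {w = x ∷ []} _ _ (w↭ , _) = contradiction (↭[1⋯]-length w↭) λ ()
IsA-exchange {w = u ∷ _ ∷ _} 1≤u u<n (w↭ , alt , refl) =
  exchange-[1⋯] 1≤u u<n w↭ , raise-alternating (↭[1⋯]-unique w↭) alt , cong just (exchange-left u (suc u))

Ins-spread-total : IsT n i S → u ≤ i → ∃ (Ins u (mapTree (spread u) S))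
Ins-spread-total {S = S} {u} (_ , S↗ , refl) u≤i = Ins-total
  (spread-increasing u S↗)
  (subst (All (Outside u)) (sym (vertices-mapTree (spread u) S))
    (All-map⁺ (All.universal (spread-outside u) (vertices S))))
  (subst (suc u <_) (sym (trans (p-mapTree (spread u) S) (spread-≥ u≤i))) (s≤s (s≤s u≤i)))

IsT-ins : 1 ≤ u → u ≤ i → IsT (suc n) i S → Ins u (mapTree (spread u) S) T → IsT (3 + n) (suc u) T
IsT-ins {u} {S = S} 1≤u u≤i s@(S↭ , S↗ , _) ins =
  ↭-trans (Ins-vertices ins)
    (subst (λ l → u ∷ suc u ∷ l ↭ _) (sym (vertices-mapTree (spread u) S))
      (spread-[1⋯] 1≤u (m≤n⇒m≤1+n (≤-trans u≤i (proj₂ (IsT-bounds s)))) S↭)) ,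
  Ins-increasing (spread-increasing u S↗) ins ,
  Ins-p ins

-- The tree S′ avoids u and u + 1, so squeezing loses nothing. Its chain end is at least u + 2,
-- which squeezes to i ≥ u.
IsT-ins⁻ : 1 ≤ u → IsT (3 + n) (suc u) T → Ins u S′ T →
           ∃ λ S → ∃ λ i → u ≤ i × IsT (suc n) i S × Ins u (mapTree (spread u) S) T
IsT-ins⁻ {u} {T = T} {S′} 1≤u t@(T↭ , T↗ , _) ins =
  R , p R , u≤p , (R↭ , R↗ , refl) , subst (λ s → Ins u s T) (sym spread-R) ins
  where
  R = mapTree (squeeze u) S′
  S′↗ = Ins-increasing⁻ T↗ ins
  squeezed = squeeze-[1⋯] 1≤u (s≤s⁻¹ (proj₂ (IsT-bounds t))) (↭-trans (↭-sym (Ins-vertices ins)) T↭)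
  off = proj₂ squeezed
  R↭ : vertices R ↭ _
  R↭ = subst (_↭ _) (sym (vertices-mapTree (squeeze u) S′)) (proj₁ squeezed)
  R↗ = mapTree-increasing squeeze-mono off S′↗
  spread-R : mapTree (spread u) R ≡ S′
  spread-R = mapTree-inverse S′ (All.map spread-squeeze off)
  v<p = Ins-p⁻ S′↗ ins
  u≤p : u ≤ p R
  u≤p = subst (u ≤_) (sym (trans (p-mapTree (squeeze u) S′) (squeeze-> v<p))) (∸-monoˡ-≤ 2 v<p)

Unex-total : IsT n u S → ∃ (Unex u S)
Unex-total {u = u} {S} s@(_ , S↗ , p≡u) with siblings? u (suc u) S
... | yes sib = _ , rear (proj₂ (Rear-total S↗ (IsT-distinct s) p≡u sib))
... | no ¬sib = _ , relabel ¬sib refl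

exchange-vertices : 1 ≤ u → u < 3 + n → ∀ T → vertices T ↭ [1⋯ 3 + n ] →
                    vertices (mapTree (exchange u (suc u)) T) ↭ [1⋯ 3 + n ]
exchange-vertices 1≤u u<n T T↭ =
  subst (_↭ _) (sym (vertices-mapTree _ T)) (exchange-[1⋯] 1≤u u<n T↭)

IsT-unex : 1 ≤ u → u < 3 + n → IsT (3 + n) u S → Unex u S T → IsT (3 + n) (suc u) T
IsT-unex _ _ (S↭ , S↗ , _) (rear r) = ↭-trans (Rear-vertices r) S↭ , Rear-increasing S↗ r , Rear-p r
IsT-unex {u} {S = S} 1≤u u<n s@(S↭ , S↗ , p≡u) (relabel ¬sib refl) =
  exchange-vertices 1≤u u<n S S↭ ,
  exchange-increasing S↗ (p-no-Child S↗ (IsT-distinct s) p≡u) ¬sib ,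
  trans (p-mapTree _ S) (trans (cong (exchange u (suc u)) p≡u) (exchange-left u (suc u)))

IsT-rear⁻ : IsT n (suc u) T → Rear u S T → IsT n u S
IsT-rear⁻ (T↭ , T↗ , _) r = ↭-trans (↭-sym (Rear-vertices r)) T↭ , Rear-increasing⁻ T↗ r , Rear-p⁻ r

-- The exchange is its own inverse. The chain end u + 1 has no smaller sibling, so in the absence of
-- an edge from u to u + 1 the labels can be exchanged back.
IsT-relabel⁻ : 1 ≤ u → IsT (3 + n) (suc u) T → ¬ Child u (suc u) T →
               ∃ λ S → IsT (3 + n) u S × Unex u S T
IsT-relabel⁻ {u} {T = T} 1≤u t@(T↭ , T↗ , p≡v) ¬c =
  mapTree e T ,
  (exchange-vertices 1≤u (proj₂ (IsT-bounds t)) T T↭ ,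
   exchange-increasing T↗ ¬c ¬sib ,
   trans (p-mapTree e T) (trans (cong e p≡v) (exchange-right u (suc u)))) ,
  relabel (¬sib ∘ Siblings-exchange T) (sym (mapTree-exchange-involutive u (suc u) T))
  where
  e = exchange u (suc u)
  ¬sib = p-no-smaller-sibling T↗ (IsT-distinct t) p≡v (n<1+n u)

-- Insertion creates an edge from u to u + 1, which relabelling cannot; against rearrangement
-- `Ins-Rear-disjoint` decides.
Ins-Unex-disjoint : Increasing S′ → Ins u S T → ¬ Unex u S′ T
Ins-Unex-disjoint _ ins (rear r) = Ins-Rear-disjoint ins r
Ins-Unex-disjoint {S′} S′↗ ins (relabel _ refl) =
  <-asym (n<1+n _) (Child-< S′↗ (Child-exchange S′ (Ins-Child ins)))

Unex-injective : Increasing S → Increasing S′ → Unex u S T → Unex u S′ T → S ≡ S′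
Unex-injective _ _ (rear r) (rear r′) = Rear-injective r r′
Unex-injective {S′ = S′} _ S′↗ (rear r) (relabel _ refl) =
  contradiction (Child-< S′↗ (Child-exchange S′ (Rear-Child r))) (<-asym (n<1+n _))
Unex-injective {S} S↗ _ (relabel _ refl) (rear r) =
  contradiction (Child-< S↗ (Child-exchange S (Rear-Child r))) (<-asym (n<1+n _))
Unex-injective {S} {S′} {u} _ _ (relabel _ eq) (relabel _ eq′) =
  trans (sym (mapTree-exchange-involutive u (suc u) S))
    (trans (cong (mapTree (exchange u (suc u))) (trans (sym eq) eq′))
           (mapTree-exchange-involutive u (suc u) S′))

-- The graph of φ

data Φ : ℕ → ℕ → List ℕ → Tree → Set where
  one  : Φ 1 1 (1 ∷ []) (leaf 1)
  two  : Φ 2 2 (2 ∷ 1 ∷ []) (node₁ 1 (leaf 2))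
  ins  : 1 ≤ u → u ≤ i → Φ (suc n) i w S → Ins u (mapTree (spread u) S) T →
         Φ (3 + n) (suc u) (suc u ∷ u ∷ map (spread u) w) T
  -- The word w begins with u and alternates, so its second entry is below u; this is the condition
  -- π₂ < k - 1.
  exch : 1 ≤ u → u < 3 + n → Φ (3 + n) u w S → Unex u S T →
         Φ (3 + n) (suc u) (map (exchange u (suc u)) w) T

Φ⇒IsA : Φ n k w T → IsA n k w
Φ⇒IsA one                  = ↭-refl , [-] , refl
Φ⇒IsA two                  = swap _ _ ↭-refl , ≤-refl ∷ [-] , refl
Φ⇒IsA (ins 1≤u u≤i q _)    = IsA-ins 1≤u u≤i (Φ⇒IsA q)
Φ⇒IsA (exch 1≤u u<n q _)   = IsA-exchange 1≤u u<n (Φ⇒IsA q)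

Φ⇒IsT : Φ n k w T → IsT n k T
Φ⇒IsT one                    = ↭-refl , leaf , refl
Φ⇒IsT two                    = ↭-refl , node₁ ≤-refl leaf , refl
Φ⇒IsT (ins 1≤u u≤i q i)      = IsT-ins 1≤u u≤i (Φ⇒IsT q) i
Φ⇒IsT (exch 1≤u u<n q x)     = IsT-unex 1≤u u<n (Φ⇒IsT q) x

-- Every pair in the graph is a value of `φ`

φ-ins : u ≤ i → head w ≡ just i → φ (suc n) i w ≡ just S →
        insert u (suc u) (mapTree (spread u) S) ≡ just T →
        φ (3 + n) (suc u) (suc u ∷ u ∷ map (spread u) w) ≡ just T
φ-ins {u} {i} {i ∷ w} {n} u≤i refl φ≡ insert≡ with <-cmp u u
... | tri< u<u _ _ = contradiction u<u (<-irrefl refl)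
... | tri> _ _ u<u = contradiction u<u (<-irrefl refl)
... | tri≈ _ _ _   = trans (cong (_>>= _) (trans squeezed φ≡)) insert≡
  where
  -- The recursive call of `φ` subtracts 2 from the first entry and squeezes the word, which undoes
  -- the spreading in both arguments.
  squeezed : φ (suc n) (spread u i ∸ 2) (map (squeeze u) (map (spread u) (i ∷ w))) ≡ φ (suc n) i (i ∷ w)
  squeezed = cong₂ (φ (suc n)) (cong (_∸ 2) (spread-≥ u≤i)) (map-squeeze-spread u (i ∷ w))

φ-exchange : IsA (3 + n) u w → φ (3 + n) u w ≡ just S → unexchange u (suc u) S ≡ just T →
             φ (3 + n) (suc u) (map (exchange u (suc u)) w) ≡ just T
φ-exchange {w = _ ∷ []}     (w↭ , _) = contradiction (↭[1⋯]-length w↭) λ ()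
φ-exchange {w = _ ∷ _ ∷ []} (w↭ , _) = contradiction (↭[1⋯]-length w↭) λ ()
φ-exchange {n} {u} {w@(_ ∷ y ∷ _ ∷ _)} (_ , y<u ∷ _ , refl) φ≡ unexchange≡
  with <-cmp (exchange u (suc u) y) u
-- The second entry is below u and hence fixed, which forces this branch; the exchange made by `φ`
-- cancels the one in the word.
... | tri< _ _ _    =
  trans (cong (_>>= _) (trans (cong (φ (3 + n) u) (map-exchange-involutive u (suc u) w)) φ≡)) unexchange≡
... | tri≈ ey≮u _ _ = contradiction (subst (_< u) (sym (exchange-below y<u)) y<u) ey≮u
... | tri> ey≮u _ _ = contradiction (subst (_< u) (sym (exchange-below y<u)) y<u) ey≮u

Φ⇒φ : Φ n k w T → φ n k w ≡ just T
Φ⇒φ one            = refl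
Φ⇒φ two            = refl
Φ⇒φ (ins _ u≤i q j) = φ-ins u≤i (proj₂ (proj₂ (Φ⇒IsA q))) (Φ⇒φ q) (Ins⇒insert j)
Φ⇒φ (exch _ _ q x)  = φ-exchange (Φ⇒IsA q) (Φ⇒φ q) (Unex⇒unexchange (proj₁ (proj₂ (Φ⇒IsT q))) x)

-- Totality: every alternating permutation occurs in the graph

IsA-split : IsA (3 + n) (suc u) w → 1 ≤ u ×
  ((∃₂ λ i π → u ≤ i × IsA (suc n) i π × w ≡ suc u ∷ u ∷ map (spread u) π) ⊎
   (∃ λ π → IsA (3 + n) u π × w ≡ map (exchange u (suc u)) π))
IsA-split {w = []}         (_ , _ , ())
IsA-split {w = _ ∷ []}     (w↭ , _) = contradiction (↭[1⋯]-length w↭) λ ()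
IsA-split {w = _ ∷ _ ∷ []} (w↭ , _) = contradiction (↭[1⋯]-length w↭) λ ()
IsA-split {n} {u} {w@(_ ∷ y ∷ z ∷ π)} a@(w↭ , alt@(y<v ∷ y<z ∷ alt′) , refl)
  with _ ∷ (1≤y , _) ∷ _ ← ↭[1⋯]-bounds w↭ with <-cmp y u
... | tri> _ _ u<y = contradiction (s≤s⁻¹ y<v) (<⇒≱ u<y)
... | tri< y<u _ _ =
  ≤-trans 1≤y (<⇒≤ y<u) , inj₂
    (map (exchange u (suc u)) w ,
     (exchange-[1⋯] (≤-trans 1≤y (<⇒≤ y<u)) (proj₂ (IsA-bounds a)) w↭ ,
      lower-alternating y<u (↭[1⋯]-unique w↭) alt ,
      cong just (exchange-right u (suc u))) ,
     sym (map-exchange-involutive u (suc u) w))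
... | tri≈ _ refl _
  with π↭ , off ← squeeze-[1⋯] 1≤y (s≤s⁻¹ (proj₂ (IsA-bounds a))) (↭-trans (swap y (suc y) ↭-refl) w↭)
  with All.head off
-- Alternation gives π₃ > π₂ = u, so among the labels outside the pair π₃ lies above u + 1.
...   | inj₁ z<u = contradiction z<u (<-asym y<z)
...   | inj₂ v<z =
  1≤y , inj₁
    (z ∸ 2 , map (squeeze y) (z ∷ π) , ∸-monoˡ-≤ 2 v<z ,
     (π↭ , map-alternating↓ squeeze-mono off alt′ , cong just (squeeze-> v<z)) ,
     cong (λ π → suc y ∷ y ∷ π) (sym (map-spread-squeeze off)))

-- The recursive calls of the two inductions on (n , k) are passed as arguments:
-- made under a `with`, their descent would escape the termination checker.
Φ-total-step : (∀ i w → IsA (suc n) i w → ∃ (Φ (suc n) i w)) →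
               (∀ w → IsA (3 + n) u w → ∃ (Φ (3 + n) u w)) →
               ∀ w → IsA (3 + n) (suc u) w → ∃ (Φ (3 + n) (suc u) w)
Φ-total-step rec₁ rec₂ w a with IsA-split a
... | 1≤u , inj₁ (i , π , u≤i , b , refl) =
  let _ , q = rec₁ i π b
      _ , j = Ins-spread-total (Φ⇒IsT q) u≤i
  in _ , ins 1≤u u≤i q j
... | 1≤u , inj₂ (π , b , refl) =
  let _ , q = rec₂ π b
      _ , x = Unex-total (Φ⇒IsT q)
  in _ , exch 1≤u (proj₂ (IsA-bounds a)) q x

Φ-total : ∀ n k w → IsA n k w → ∃ (Φ n k w)
Φ-total zero k w a with z≤n ← proj₂ (IsA-bounds a) = contradiction (proj₁ (IsA-bounds a)) λ ()
Φ-total 1 k w (w↭ , _ , eq) with refl ← ↭-singleton-inv w↭ with refl ← eq = _ , one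
Φ-total 2 k []          (_ , _ , ())
Φ-total 2 k (_ ∷ [])    (w↭ , _) = contradiction (↭[1⋯]-length w↭) λ ()
Φ-total 2 k (x ∷ y ∷ _ ∷ _) (w↭ , _) = contradiction (↭[1⋯]-length w↭) λ ()
Φ-total 2 k (x ∷ y ∷ []) (w↭ , y<x ∷ _ , refl) with ↭[1⋯]-bounds w↭
... | (_ , x≤2) ∷ (1≤y , _) ∷ []
  with refl ← ≤-antisym x≤2 (≤-<-trans 1≤y y<x) with refl ← ≤-antisym (s≤s⁻¹ y<x) 1≤y = _ , two
Φ-total (suc (suc (suc n))) zero w a = contradiction (proj₁ (IsA-bounds a)) λ ()
Φ-total (suc (suc (suc n))) (suc u) = Φ-total-step (Φ-total (suc n)) (Φ-total (suc (suc (suc n))) u)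

-- Surjectivity: every increasing tree occurs in the graph

vertices-nonempty : ∀ T → 1 ≤ length (vertices T)
vertices-nonempty (leaf _)      = s≤s z≤n
vertices-nonempty (node₁ _ _)   = s≤s z≤n
vertices-nonempty (node₂ _ _ _) = s≤s z≤n

2<node₂ : ∀ x s t → 2 < length (vertices (node₂ x s t))
2<node₂ x s t = s≤s (≤-trans (+-mono-≤ (vertices-nonempty s) (vertices-nonempty t))
                             (≤-reflexive (sym (length-++ (vertices s)))))

root<p : 1 < length (vertices T) → Increasing T → root T < p T
root<p (s≤s ()) leaf
root<p _ (node₁ x<s s↗)       = <-≤-trans x<s (root≤p s↗)
root<p _ (node₂ x<s _ _ s↗ _) = <-≤-trans x<s (root≤p s↗)

-- The edge from u to u + 1 decides: without it T is a relabelling, with it `Child⇒ChainEdge`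
-- applies. The bound 1 ≤ u holds because the root is at least 1 and lies below the chain end u + 1.
IsT-split : IsT (3 + n) (suc u) T → 1 ≤ u ×
  ((∃₂ λ S i → u ≤ i × IsT (suc n) i S × Ins u (mapTree (spread u) S) T) ⊎
   (∃ λ S → IsT (3 + n) u S × Unex u S T))
IsT-split {n} {u} {T} t@(T↭ , T↗ , p≡v) = 1≤u , split
  where
  1≤u : 1 ≤ u
  1≤u = s≤s⁻¹ (≤-<-trans (proj₁ (All.lookup (↭[1⋯]-bounds T↭) (root∈ T)))
    (subst (root T <_) p≡v (root<p (subst (1 <_) (sym (↭[1⋯]-length T↭)) (s≤s (s≤s z≤n))) T↗)))
  split : (∃₂ λ S i → u ≤ i × IsT (suc n) i S × Ins u (mapTree (spread u) S) T) ⊎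
          (∃ λ S → IsT (3 + n) u S × Unex u S T)
  split with child? u (suc u) T
  ... | no ¬c = inj₂ (IsT-relabel⁻ 1≤u t ¬c)
  ... | yes c with Child⇒ChainEdge T↗ (IsT-distinct t) p≡v c
  -- This shape has two vertices, but T has at least three.
  ...   | inj₁ refl           = contradiction (↭[1⋯]-length T↭) λ ()
  ...   | inj₂ (inj₁ (_ , j)) = inj₁ (IsT-ins⁻ 1≤u t j)
  ...   | inj₂ (inj₂ (_ , r)) = inj₂ (_ , IsT-rear⁻ t r , rear r)

Φ-surjective-step : (∀ i S → IsT (suc n) i S → ∃ λ w → Φ (suc n) i w S) →
                    (∀ S → IsT (3 + n) u S → ∃ λ w → Φ (3 + n) u w S) →
                    ∀ T → IsT (3 + n) (suc u) T → ∃ λ w → Φ (3 + n) (suc u) w T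
Φ-surjective-step rec₁ rec₂ T t with IsT-split t
... | 1≤u , inj₁ (S , i , u≤i , s , j) = let _ , q = rec₁ i S s in _ , ins 1≤u u≤i q j
... | 1≤u , inj₂ (S , s , x) = let _ , q = rec₂ S s in _ , exch 1≤u (proj₂ (IsT-bounds t)) q x

Φ-surjective : ∀ n k T → IsT n k T → ∃ λ w → Φ n k w T
Φ-surjective zero k T (T↭ , _) = contradiction (vertices-nonempty T) (<⇒≱ (≤-reflexive (cong suc (↭[1⋯]-length T↭))))
Φ-surjective 1 k (leaf x) (T↭ , _ , refl) with refl ← ↭-singleton-inv T↭ = _ , one
Φ-surjective 1 k (node₁ x s) (T↭ , _) =
  contradiction (suc-injective (↭[1⋯]-length T↭)) (≢-sym (<⇒≢ (vertices-nonempty s)))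
Φ-surjective 1 k (node₂ x s t) (T↭ , _) =
  contradiction (↭[1⋯]-length T↭) (≢-sym (<⇒≢ (<-trans (n<1+n 1) (2<node₂ x s t))))
Φ-surjective 2 k (leaf x) (T↭ , _) = contradiction (↭[1⋯]-length T↭) λ ()
Φ-surjective 2 k (node₁ x (leaf y)) (T↭ , node₁ x<y _ , refl) with ↭[1⋯]-bounds T↭
... | (1≤x , _) ∷ (_ , y≤2) ∷ []
  with refl ← ≤-antisym y≤2 (≤-<-trans 1≤x x<y) with refl ← ≤-antisym (s≤s⁻¹ x<y) 1≤x = _ , two
Φ-surjective 2 k (node₁ x (node₁ y s)) (T↭ , _) =
  contradiction (suc-injective (suc-injective (↭[1⋯]-length T↭))) (≢-sym (<⇒≢ (vertices-nonempty s)))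
Φ-surjective 2 k (node₁ x (node₂ y s t)) (T↭ , _) =
  contradiction (↭[1⋯]-length T↭) (≢-sym (<⇒≢ (<-trans (2<node₂ y s t) (n<1+n _))))
Φ-surjective 2 k (node₂ x s t) (T↭ , _) =
  contradiction (↭[1⋯]-length T↭) (≢-sym (<⇒≢ (2<node₂ x s t)))
Φ-surjective (suc (suc (suc n))) zero T t = contradiction (proj₁ (IsT-bounds t)) λ ()
Φ-surjective (suc (suc (suc n))) (suc u) =
  Φ-surjective-step (Φ-surjective (suc n)) (Φ-surjective (suc (suc (suc n))) u)

-- Injectivity: a tree determines its word

mapTree-spread-injective : mapTree (spread u) S ≡ mapTree (spread u) S′ → S ≡ S′
mapTree-spread-injective {u} {S} {S′} eq =
  trans (sym (undo S)) (trans (cong (mapTree (squeeze u)) eq) (undo S′))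
  where
  undo : ∀ T → mapTree (squeeze u) (mapTree (spread u) T) ≡ T
  undo T = mapTree-inverse T (All.universal (squeeze-spread u) (vertices T))

Φ-injective : Φ n k w T → Φ n k w′ T → w ≡ w′
Φ-injective one one = refl
Φ-injective two two = refl
Φ-injective (ins {u} _ _ q i) (ins _ _ q′ i′)
  with refl ← mapTree-spread-injective {u} (Ins-injective i i′)
  -- The index i, hidden in each derivation, is recovered as the chain end of the common tree S.
  with refl ← trans (sym (proj₂ (proj₂ (Φ⇒IsT q)))) (proj₂ (proj₂ (Φ⇒IsT q′))) =
  cong (λ π → _ ∷ _ ∷ map (spread u) π) (Φ-injective q q′)
Φ-injective (ins _ _ _ i) (exch _ _ q x) =
  contradiction x (Ins-Unex-disjoint (proj₁ (proj₂ (Φ⇒IsT q))) i)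
Φ-injective (exch _ _ q x) (ins _ _ _ i) =
  contradiction x (Ins-Unex-disjoint (proj₁ (proj₂ (Φ⇒IsT q))) i)
Φ-injective (exch _ _ q x) (exch _ _ q′ x′)
  with refl ← Unex-injective (proj₁ (proj₂ (Φ⇒IsT q))) (proj₁ (proj₂ (Φ⇒IsT q′))) x x′ =
  cong (map (exchange _ _)) (Φ-injective q q′)

theorem1 : (n k : ℕ) → 1 ≤ n → 1 ≤ k → k ≤ n →
    Σ[ f ∈ (𝒜 n k → 𝒯 n k) ]
    ((∀ π → φ n k (𝒜.word π) ≡ just (𝒯.tree (f π))) ×
    Bijective (_≡_ on 𝒜.word) (_≡_ on 𝒯.tree) f ×
    (∀ π → head (𝒜.word π) ≡ just (p (𝒯.tree (f π)))))
theorem1 n k _ _ _ = f , φ≡ , (injective , surjective) , ends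
  where
  image : (π : 𝒜 n k) → ∃ (Φ n k (𝒜.word π))
  image π = Φ-total n k (𝒜.word π) (𝒜.permutation π , 𝒜.alternating π , 𝒜.first π)

  f : 𝒜 n k → 𝒯 n k
  f π with T , q ← image π with T↭ , T↗ , p≡k ← Φ⇒IsT q =
    record { tree = T ; vertexSet = T↭ ; increasing = T↗ ; chainEnd = p≡k }

  φ≡ : ∀ π → φ n k (𝒜.word π) ≡ just (𝒯.tree (f π))
  φ≡ π = Φ⇒φ (proj₂ (image π))

  injective : ∀ {π π′} → 𝒯.tree (f π) ≡ 𝒯.tree (f π′) → 𝒜.word π ≡ 𝒜.word π′
  injective {π} {π′} eq =
    Φ-injective (proj₂ (image π)) (subst (Φ n k (𝒜.word π′)) (sym eq) (proj₂ (image π′)))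

  surjective : ∀ T → ∃ λ π → ∀ {π′} → 𝒜.word π′ ≡ 𝒜.word π → 𝒯.tree (f π′) ≡ 𝒯.tree T
  surjective T with w , q ← Φ-surjective n k (𝒯.tree T) (𝒯.vertexSet T , 𝒯.increasing T , 𝒯.chainEnd T)
    with w↭ , alt , hd ← Φ⇒IsA q =
    record { word = w ; permutation = w↭ ; alternating = alt ; first = hd } ,
    -- The proofs carried by π′ may differ from those of the preimage, so the trees are compared
    -- through `φ`, which sees only the word.
    λ {π′} eq → just-injective (trans (sym (φ≡ π′)) (trans (cong (φ n k) eq) (Φ⇒φ q)))

  ends : ∀ π → head (𝒜.word π) ≡ just (p (𝒯.tree (f π)))
  ends π = trans (𝒜.first π) (cong just (sym (𝒯.chainEnd (f π))))
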